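{- There is an absolute constant $c>0$ such that the following holds. Let $T$ be an HST with parameter $2$ and let $R$ be a condensed set of requests issued at the leaves of $T$. Let ALG be a distributed queueing algorithm that has distance-respecting latency cost and that always produces a distance-respecting queueing order $\pi$. Then the total latency cost of ALG is at most $c\cdot\mathrm{OPT}_T(R)$.
   Context: HST with parameter $2$: rooted tree with all leaves at the same depth, leaves on level $0$, root on level $h$, each edge from a level-$\ell$ node to a child of length $2^{\ell-1}$; $d_T$ is tree distance. Requests $r=(v,t)$ issued at node $v$ at time $t\ge0$; a dummy request $r_0=(v_0,0)$ must be ordered first by any algorithm. A queueing algorithm ALG orders $R$ as $r_{\pi(0)}=r_0,r_{\pi(1)},\dots,r_{\pi(|R|-1)}$. If ALG informs the node of $r_{\pi(i-1)}$ about $r_{\pi(i)}$ at time $t_{\mathrm{ALG}}(i)$, the latency is $L_{\mathrm{ALG}}(r_{\pi(i-1)},r_{\pi(i)})=\max\{t_{\mathrm{ALG}}(i),t_{\pi(i-1)}\}-t_{\pi(i)}$ and the total latency cost is $\sum_{i=1}^{|R|-1}L_{\mathrm{ALG}}(r_{\pi(i-1)},r_{\pi(i)})$. Distance-respecting order: whenever $r_a$ is ordered before $r_b$, $t_a-t_b\le d_T(v_a,v_b)$. Distance-respecting latency cost: for every request set and every possible order $\pi$ of ALG, for all $1\le i<j<|R|$: $t_{\pi(i)}+L_{\mathrm{ALG}}(r_{\pi(i-1)},r_{\pi(i)})\le t_{\pi(j)}+d_T(v_{\pi(j)},v_{\pi(i-1)})$. Condensed: for any two requests $r_i=(v_i,t_i),r_j=(v_j,t_j)$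 that are consecutive with respect to time of occurrence ($t_i\le t_j$), there exist requests $r_a,r_b$ with $t_a\le t_i$, $t_b\ge t_j$ and $d_T(v_a,v_b)\ge t_b-t_a$. $\mathrm{OPT}_T(R)=\min_\pi\sum_{i=1}^{|R|-1}\max\{d_T(v_{\pi(i-1)},v_{\pi(i)}),t_{\pi(i-1)}-t_{\pi(i)}\}$ over orderings with $\pi(0)=0$.
   Formalization: Adds the assumption that the latency of the last ordered request is at most its tree distance to its predecessor; without it, for |R|=2 the distance-respecting latency condition is vacuous and the latency is unbounded. Times lie in any decidable ordered field (classically including the reals). -}

module Defs where

open import Algebra.Bundles using (CommutativeRing)
open import Data.Fin.Base using (Fin; zero; suc; inject₁; toℕ)
import Data.Fin.Base as Fin
open import Data.Fin.Permutation as Perm using (Permutation′; _⟨$⟩ʳ_; lift₀; insert; remove; insert-remove; lift₀-remove)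
open import Data.Fin.Properties using (_≟_)
open import Data.List.Base using (List; []; _∷_; map; cartesianProductWith; allFin)
open import Data.List.Membership.Propositional using (_∈_)
open import Data.List.Membership.Propositional.Properties using (∈-map⁺; ∈-cartesianProductWith⁺; ∈-allFin)
open import Data.List.Relation.Unary.All as All using ()
open import Data.List.Relation.Unary.Any using (here)
import Data.List.Extrema as Extrema
open import Data.Nat.Base as ℕ using (ℕ; zero; suc; _^_)
open import Data.Product.Base using (∃; ∃₂; _×_; _,_)
open import Level using (0ℓ) renaming (suc to lsuc)
open import Relation.Binary.Bundles using (TotalOrder)
open import Relation.Binary.PropositionalEquality.Core using (_≡_; refl; trans; cong; cong₂)
open import Relation.Binary.Structures using (IsDecTotalOrder)
open import Relation.Nullary using (¬_; yes; no)
import Algebra.Construct.NaturalChoice.Max as Max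
import Algebra.Definitions.RawMonoid as RawMonoidDefs
import Algebra.Properties.Monoid.Sum as Sum

-- Time is measured in an arbitrary (decidable, totally) ordered field;
-- classically ℝ is an instance, and so is ℚ.

record OrderedField : Set (lsuc 0ℓ) where
  infix 4 _≤_
  field
    commutativeRing : CommutativeRing 0ℓ 0ℓ
  open CommutativeRing commutativeRing public
  field
    _≤_             : Carrier → Carrier → Set
    isDecTotalOrder : IsDecTotalOrder _≈_ _≤_
    +-monoʳ-≤       : ∀ z {x y} → x ≤ y → z + x ≤ z + y
    *-nonNeg        : ∀ {x y} → 0# ≤ x → 0# ≤ y → 0# ≤ x * y
    1≉0             : ¬ (1# ≈ 0#)
    inverse         : ∀ x → ¬ (x ≈ 0#) → ∃ λ y → x * y ≈ 1#

  module ≤ = IsDecTotalOrder isDecTotalOrder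

  totalOrder : TotalOrder 0ℓ 0ℓ 0ℓ
  totalOrder = record { isTotalOrder = ≤.isTotalOrder }

  open Max totalOrder public using (_⊔_)
  open Sum +-monoid public using (sum; sum-cong-≗)

  infix 4 _<_
  _<_ : Carrier → Carrier → Set
  x < y = x ≤ y × ¬ (x ≈ y)

  fromℕ : ℕ → Carrier
  fromℕ n = n ·ℕ 1#
    where open RawMonoidDefs +-rawMonoid renaming (_×_ to _·ℕ_)

-- HST h: tree whose root is on level h and whose leaves are all on level 0.
-- Every inner node has at least one child, so no leaf lies above level 0.

data HST : ℕ → Set where
  leaf : HST 0
  node : ∀ {h} (k : ℕ) → (Fin (suc k) → HST h) → HST (suc h)

data Node : ∀ {h} → HST h → Set where
  root  : ∀ {h} {T : HST h} → Node T
  below : ∀ {h k} {child : Fin (suc k) → HST h} (i : Fin (suc k)) → Node (child i) → Node (node k child)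

level : ∀ {h} {T : HST h} → Node T → ℕ
level {h} root    = h
level (below _ v) = level v

-- The edge from the root of an HST (suc h), on level suc h, to each of its
-- children has length 2 ^ h.

rootDist : ∀ {h} {T : HST h} → Node T → ℕ
rootDist root                = 0
rootDist {suc h} (below _ v) = 2 ^ h ℕ.+ rootDist v

-- Length of the tree path: it passes through the current root exactly when
-- the two nodes do not lie below a common child.

dist : ∀ {h} {T : HST h} → Node T → Node T → ℕ
dist root v = rootDist v
dist u@(below _ _) root = rootDist u
dist {T = T} (below i u) (below j v) with i ≟ j
... | yes refl = dist u v
... | no _     = rootDist {T = T} (below i u) ℕ.+ rootDist {T = T} (below j v)

-- Orders of suc m requests, as maps from positions to request indices; the
-- dummy request has index zero.

record Order (m : ℕ) : Set where
  constructor mkOrder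
  field
    perm       : Permutation′ (suc m)
    dummyFirst : perm ⟨$⟩ʳ zero ≡ zero

  at : Fin (suc m) → Fin (suc m)
  at i = perm ⟨$⟩ʳ i

open Order public using (at)

allPermutations : ∀ n → List (Permutation′ n)
allPermutations zero    = Perm.id ∷ []
allPermutations (suc n) = cartesianProductWith (insert zero) (allFin (suc n)) (allPermutations n)

allOrders : ∀ m → List (Order m)
allOrders m = map (λ π → mkOrder (lift₀ π) refl) (allPermutations m)

insert-cong : ∀ {n} j (π ρ : Permutation′ n) → π Perm.≈ ρ → insert zero j π Perm.≈ insert zero j ρ
insert-cong j π ρ π≈ρ zero    = refl
insert-cong j π ρ π≈ρ (suc i) = cong (Fin.punchIn j) (π≈ρ i)

allPermutations-complete : ∀ n (π : Permutation′ n) → ∃ λ ρ → ρ ∈ allPermutations n × ρ Perm.≈ π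
allPermutations-complete zero π = Perm.id , here refl , λ ()
allPermutations-complete (suc n) π with allPermutations-complete n (remove zero π)
... | ρ , ρ∈ , ρ≈ = insert zero (π ⟨$⟩ʳ zero) ρ
  , ∈-cartesianProductWith⁺ (insert zero) (∈-allFin (π ⟨$⟩ʳ zero)) ρ∈
  , λ i → trans (insert-cong (π ⟨$⟩ʳ zero) ρ (remove zero π) ρ≈ i) (insert-remove zero π i)

allOrders-complete : ∀ m (π : Order m) → ∃ λ ρ → ρ ∈ allOrders m × (∀ i → at ρ i ≡ at π i)
allOrders-complete m (mkOrder π π0) with allPermutations-complete m (remove zero π)
... | ρ , ρ∈ , ρ≈ = mkOrder (lift₀ ρ) refl
  , ∈-map⁺ (λ σ → mkOrder (lift₀ σ) refl) ρ∈
  , λ i → trans (Perm.lift₀-cong ρ (remove zero π) ρ≈ i) (lift₀-remove π π0 i)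

module Queueing (K : OrderedField) {h : ℕ} (T : HST h) where
  open OrderedField K hiding (zero; refl; sym; trans)
  open Extrema totalOrder using (argmin; f[argmin]≤f[xs])

  -- Index zero is the dummy request r₀, so |R| = suc m.

  record RequestSet : Set where
    field
      m          : ℕ
      loc        : Fin (suc m) → Node T
      time       : Fin (suc m) → Carrier
      time-dummy : time zero ≈ 0#
      time-nonNeg : ∀ r → 0# ≤ time r

    d : Fin (suc m) → Fin (suc m) → Carrier
    d r s = fromℕ (dist (loc r) (loc s))

    AtLeaves : Set
    AtLeaves = ∀ r → level (loc r) ≡ 0

    Consecutive : Fin (suc m) → Fin (suc m) → Set
    Consecutive r s = ¬ (r ≡ s) × time r ≤ time s × (∀ q → ¬ (time r < time q × time q < time s))

    Condensed : Set
    Condensed = ∀ r s → Consecutive r s →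
      ∃₂ λ a b → time a ≤ time r × time s ≤ time b × time b - time a ≤ d a b

    orderCost : Order m → Carrier
    orderCost π = sum λ (i : Fin m) →
      let p = at π (inject₁ i) ; q = at π (suc i) in d p q ⊔ (time p - time q)

    OPT : Carrier
    OPT = orderCost (argmin orderCost (mkOrder Perm.id refl) (allOrders m))

    OPT-minimal : ∀ π → OPT ≤ orderCost π
    OPT-minimal π with allOrders-complete m π
    ... | ρ , ρ∈ , ρ≗π = ≤.trans
      (All.lookup (f[argmin]≤f[xs] (mkOrder Perm.id refl) (allOrders m)) ρ∈)
      (≤.reflexive (reflexive (sum-cong-≗ λ i →
        cong₂ (λ p q → d p q ⊔ (time p - time q)) (ρ≗π (inject₁ i)) (ρ≗π (suc i)))))

  open RequestSet public

  -- i : Fin m stands for the position suc i, whose predecessor is inject₁ i.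
  -- informTime i is the time at which the node of the request at position
  -- inject₁ i is informed about the request at position suc i.

  record Execution (R : RequestSet) : Set where
    field
      order      : Order (m R)
      informTime : Fin (m R) → Carrier

    prev cur : Fin (m R) → Fin (suc (m R))
    prev i = at order (inject₁ i)
    cur  i = at order (suc i)

    latency : Fin (m R) → Carrier
    latency i = (informTime i ⊔ time R (prev i)) - time R (cur i)

    totalLatency : Carrier
    totalLatency = sum latency

  open Execution public

  -- An algorithm is given by its possible executions on every request set.
  -- (Several are possible because message delays are not under its control.)

  Algorithm : Set₁
  Algorithm = (R : RequestSet) → Execution R → Set

  HasDistanceRespectingOrder : Algorithm → Set
  HasDistanceRespectingOrder ALG = ∀ R (E : Execution R) → ALG R E →
    ∀ (i j : Fin (suc (m R))) → i Fin.< j →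
    let a = at (order E) i ; b = at (order E) j in
    time R a - time R b ≤ d R a b

  HasDistanceRespectingLatency : Algorithm → Set
  HasDistanceRespectingLatency ALG = ∀ R (E : Execution R) → ALG R E →
    ∀ (i j : Fin (m R)) → i Fin.< j →
    time R (cur E i) + latency E i ≤ time R (cur E j) + d R (cur E j) (prev E i)

  -- The previous condition says nothing about the latency of the last
  -- request in the order, which could therefore be arbitrarily large.  This is
  -- its instance i = j for that request alone.

  HasDistanceRespectingFinalLatency : Algorithm → Set
  HasDistanceRespectingFinalLatency ALG = ∀ R (E : Execution R) → ALG R E →
    ∀ (i : Fin (m R)) → suc (toℕ i) ≡ m R →
    time R (cur E i) + latency E i ≤ time R (cur E i) + d R (cur E i) (prev E i)

{-# OPTIONS --safe #-}

-- Write N i for the time at which position i of ALG's order is both issued and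
-- informed.  Total latency telescopes to at most the sum of F i = N i − t i, and
-- N i ≤ t q + d(q, i) for every request q at position at least i + 2.
--
-- Take an optimal tour and give each of its steps a weight dominating both the
-- distance and the time difference.  If the tour connects position i to some
-- position at least i + 2 by steps of weight at most x, then F i ≤ 4 x: distances
-- between leaves form an ultrametric, so the tour stays within distance x of i, and
-- because the order respects distances it first reaches a position beyond i + 1
-- by time t i + 3 x.  Now remove the requests from the tour in ALG's order,
-- separately for even and odd positions.  Removing a request lowers the weight of
-- the tour by the lighter of its two steps, which pays for F i.  So the sum of the
-- F i is at most a constant times the weight of the tour.
--
-- That weight is twice the cost plus the time at which the tour ends.  Since
-- the request set is condensed, every step of the tour lies in a stretch of the tour
-- over which the maximal time so far grows by at most twice the cost.  Covering the
-- tour by such stretches with multiplicity two bounds all times by four times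
-- the cost.
module Submission where

open import Defs
open import Data.Nat.Base as ℕ using (ℕ; zero; suc; _^_)
open import Data.Product.Base using (Σ; ∃; ∃₂; _×_; _,_)
import Algebra.Construct.NaturalChoice.Max as Max
import Algebra.Properties.CommutativeMonoid.Sum as SumProperties
import Algebra.Properties.Monoid.Mult.TCOptimised as MultProperties
import Algebra.Properties.Ring as RingProperties
import Algebra.Solver.Ring.NaturalCoefficients.Default as Solver
open import Data.Fin.Base as Fin using (Fin; zero; suc; inject₁; toℕ)
open import Data.Fin.Permutation as Perm using (Permutation′; _⟨$⟩ʳ_; _⟨$⟩ˡ_; inverseˡ; inverseʳ)
import Data.Fin.Properties as Finₚ
open import Data.List.Base using (List; []; _∷_; _++_; foldr; map; tabulate; allFin; filter)
import Data.List.Extrema as Extrema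
import Data.List.Properties as Listₚ
open import Data.List.Membership.Propositional using (_∈_)
open import Data.List.Membership.Propositional.Properties using (∈-∃++; ∈-tabulate⁺; ∈-allFin; ∈-filter⁺; ∈-map⁻)
open import Data.List.Membership.Propositional.Properties.WithK using (unique∧set⇒bag)
open import Data.List.Relation.Binary.BagAndSetEquality using (∼bag⇒↭)
open import Data.List.Relation.Binary.Permutation.Propositional using (_↭_; ↭-refl; ↭-sym; ↭-trans; prep; swap; module PermutationReasoning)
open import Data.List.Relation.Binary.Permutation.Propositional.Properties using (∈-resp-↭; drop-mid; ↭-empty-inv; ++-comm; map⁺)
open import Data.List.Relation.Unary.All as All using (All; []; _∷_)
import Data.List.Relation.Unary.All.Properties as Allₚ
open import Data.List.Relation.Unary.AllPairs as AllPairs using (AllPairs; []; _∷_)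
import Data.List.Relation.Unary.AllPairs.Properties as AllPairsₚ
open import Data.List.Relation.Unary.Any using (here; there)
import Data.List.Relation.Unary.Unique.Propositional.Properties as Uniqueₚ
import Data.Nat.Properties as ℕₚ
open import Data.Sum.Base using (_⊎_; inj₁; inj₂)
open import Function.Base using (_∘_; id)
open import Function.Bundles using (mk⇔)
open import Relation.Binary.Construct.Closure.ReflexiveTransitive as Star using (Star; ε; _◅_; _◅◅_)
open import Relation.Binary.PropositionalEquality using (_≡_; _≢_; refl; sym; trans; cong; cong₂; subst; subst₂)
import Relation.Binary.Reasoning.Setoid as SetoidReasoning
open import Relation.Nullary using (¬_; Dec; yes; no; contradiction)
open import Relation.Nullary.Decidable using (¬?)

-- Distances between the leaves of an HST.

leafDepth : ℕ → ℕ
leafDepth zero    = 0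
leafDepth (suc h) = 2 ^ h ℕ.+ leafDepth h

rootDist-leaf : ∀ {h} {T : HST h} (u : Node T) → level u ≡ 0 → rootDist u ≡ leafDepth h
rootDist-leaf {zero}  root        _ = refl
rootDist-leaf {suc h} root        ()
rootDist-leaf {suc h} (below i u) u₀ = cong (2 ^ h ℕ.+_) (rootDist-leaf u u₀)

dist-refl : ∀ {h} {T : HST h} (u : Node T) → dist u u ≡ 0
dist-refl root        = refl
dist-refl (below i u) with i Finₚ.≟ i
... | yes refl = dist-refl u
... | no i≢i   = contradiction refl i≢i

dist-sym : ∀ {h} {T : HST h} (u v : Node T) → dist u v ≡ dist v u
dist-sym root        root        = refl
dist-sym root        (below j v) = refl
dist-sym (below i u) root        = refl
dist-sym {T = T} (below i u) (below j v) with i Finₚ.≟ j | j Finₚ.≟ i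
... | yes refl | yes refl = dist-sym u v
... | yes refl | no i≢i   = contradiction refl i≢i
... | no i≢i   | yes refl = contradiction refl i≢i
... | no _     | no _     = ℕₚ.+-comm (rootDist {T = T} (below i u)) _

-- The right side is 2(2^h - 1), the length of a path between leaves that passes through the root.
dist≤2*leafDepth : ∀ {h} {T : HST h} (u v : Node T) → level u ≡ 0 → level v ≡ 0 →
                   dist u v ℕ.≤ leafDepth h ℕ.+ leafDepth h
dist≤2*leafDepth {zero}  root root _ _ = ℕ.z≤n
dist≤2*leafDepth {suc h} root _ () _
dist≤2*leafDepth {suc h} (below _ _) root _ ()
dist≤2*leafDepth {suc h} (below i u) (below j v) u₀ v₀ with i Finₚ.≟ j
... | yes refl = ℕₚ.≤-trans (dist≤2*leafDepth u v u₀ v₀) (ℕₚ.+-mono-≤ (ℕₚ.m≤n+m _ (2 ^ h)) (ℕₚ.m≤n+m _ (2 ^ h)))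
... | no _     = ℕₚ.≤-reflexive (cong₂ (λ a b → (2 ^ h ℕ.+ a) ℕ.+ (2 ^ h ℕ.+ b)) (rootDist-leaf u u₀) (rootDist-leaf v v₀))

dist-apart : ∀ {h k} {child : Fin (suc k) → HST h} {i j} (u : Node (child i)) (v : Node (child j)) →
             level u ≡ 0 → level v ≡ 0 → i ≢ j →
             dist {T = node k child} (below i u) (below j v) ≡ leafDepth (suc h) ℕ.+ leafDepth (suc h)
dist-apart {h} {i = i} {j} u v u₀ v₀ i≢j with i Finₚ.≟ j
... | yes i≡j = contradiction i≡j i≢j
... | no _    = cong₂ (λ a b → (2 ^ h ℕ.+ a) ℕ.+ (2 ^ h ℕ.+ b)) (rootDist-leaf u u₀) (rootDist-leaf v v₀)

dist-below : ∀ {h k} (child : Fin (suc k) → HST h) i (u v : Node (child i)) →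
             dist {T = node k child} (below i u) (below i v) ≡ dist u v
dist-below child i u v with i Finₚ.≟ i
... | yes refl = refl
... | no i≢i   = contradiction refl i≢i

-- If v is separated from u or from w at the root, that distance is already the diameter; otherwise
-- all three lie below one child and the claim descends.
dist-ultrametric : ∀ {h} {T : HST h} (u v w : Node T) → level u ≡ 0 → level v ≡ 0 → level w ≡ 0 →
                   dist u w ℕ.≤ dist u v ⊎ dist u w ℕ.≤ dist v w
dist-ultrametric {zero}  root root root _ _ _ = inj₁ ℕ.z≤n
dist-ultrametric {suc h} root _ _ () _ _
dist-ultrametric {suc h} (below _ _) root _ _ () _
dist-ultrametric {suc h} (below _ _) (below _ _) root _ _ ()
dist-ultrametric {suc h} {T@(node _ child)} (below i u) (below j v) (below k w) u₀ v₀ w₀ = split (i Finₚ.≟ j) (j Finₚ.≟ k)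
  where
  diam : dist {T = T} (below i u) (below k w) ℕ.≤ leafDepth (suc h) ℕ.+ leafDepth (suc h)
  diam = dist≤2*leafDepth {T = T} (below i u) (below k w) u₀ w₀

  split : Dec (i ≡ j) → Dec (j ≡ k) →
          dist {T = T} (below i u) (below k w) ℕ.≤ dist {T = T} (below i u) (below j v) ⊎
          dist {T = T} (below i u) (below k w) ℕ.≤ dist {T = T} (below j v) (below k w)
  split (no i≢j)   _          = inj₁ (ℕₚ.≤-trans diam (ℕₚ.≤-reflexive (sym (dist-apart u v u₀ v₀ i≢j))))
  split (yes _)    (no j≢k)   = inj₂ (ℕₚ.≤-trans diam (ℕₚ.≤-reflexive (sym (dist-apart v w v₀ w₀ j≢k))))
  split (yes refl) (yes refl) with dist-ultrametric u v w u₀ v₀ w₀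
  ... | inj₁ le = inj₁ (subst₂ ℕ._≤_ (sym (dist-below child i u w)) (sym (dist-below child i u v)) le)
  ... | inj₂ le = inj₂ (subst₂ ℕ._≤_ (sym (dist-below child i u w)) (sym (dist-below child i v w)) le)

-- Alternate entries of a list, and permutations of tabulated lists.

evens odds : ∀ {A : Set} → List A → List A
evens []       = []
evens (x ∷ xs) = x ∷ odds xs
odds []       = []
odds (x ∷ xs) = evens xs

evens++odds↭ : ∀ {A : Set} (xs : List A) → evens xs ++ odds xs ↭ xs
evens++odds↭ []       = ↭-refl
evens++odds↭ (x ∷ xs) = prep x (↭-trans (++-comm (odds xs) (evens xs)) (evens++odds↭ xs))

mutual
  All-evens : ∀ {A : Set} {P : A → Set} {xs} → All P xs → All P (evens xs)
  All-evens []         = []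
  All-evens (px ∷ pxs) = px ∷ All-odds pxs

  All-odds : ∀ {A : Set} {P : A → Set} {xs} → All P xs → All P (odds xs)
  All-odds []         = []
  All-odds (px ∷ pxs) = All-evens pxs

-- The separation at which the latency condition applies: it relates `prev E i` to `cur E j` for j >
-- i, whose position is at least i + 2.
2+_≤_ : ∀ {n} → Fin n → Fin n → Set
2+ i ≤ j = 2 ℕ.+ toℕ i ℕ.≤ toℕ j

mutual
  evens-spaced : ∀ {n} {is : List (Fin n)} → AllPairs Fin._<_ is → AllPairs 2+_≤_ (evens is)
  evens-spaced [] = []
  evens-spaced ([] ∷ []) = [] ∷ []
  -- The dropped entry lies strictly between i and every later kept entry.
  evens-spaced ((i<j ∷ _) ∷ (j<ks ∷ ks)) =
    All.map (ℕₚ.≤-trans (ℕ.s≤s i<j)) (All-evens j<ks) ∷ evens-spaced ks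

  odds-spaced : ∀ {n} {is : List (Fin n)} → AllPairs Fin._<_ is → AllPairs 2+_≤_ (odds is)
  odds-spaced []       = []
  odds-spaced (_ ∷ is) = evens-spaced is

tabulate-permutation : ∀ {n} (π : Permutation′ n) → tabulate (π ⟨$⟩ʳ_) ↭ allFin n
tabulate-permutation {n} π = ∼bag⇒↭ (unique∧set⇒bag
  (Uniqueₚ.tabulate⁺ injective) (Uniqueₚ.allFin⁺ n)
  (mk⇔ (λ _ → ∈-allFin _) λ _ → subst (_∈ tabulate (π ⟨$⟩ʳ_)) (inverseʳ π) (∈-tabulate⁺ _)))
  where
  injective : ∀ {i j} → π ⟨$⟩ʳ i ≡ π ⟨$⟩ʳ j → i ≡ j
  injective eq = trans (sym (inverseˡ π)) (trans (cong (π ⟨$⟩ˡ_) eq) (inverseˡ π))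

tabulate-last : ∀ {A : Set} {n} (f : Fin (suc n) → A) → tabulate f ↭ f (Fin.fromℕ n) ∷ tabulate (f ∘ inject₁)
tabulate-last {n = zero}  f = ↭-refl
tabulate-last {n = suc n} f = ↭-trans (prep _ (tabulate-last (f ∘ suc))) (swap _ _ ↭-refl)

-- Arithmetic and sums in an ordered field.

module OrderedFieldProperties (K : OrderedField) where
  open OrderedField K hiding (zero) renaming (refl to ≈-refl; sym to ≈-sym; trans to ≈-trans) public
  open Max totalOrder public using (x≤x⊔y; x≤y⊔x; ⊔-sel; ⊔-lub)
  open RingProperties ring using (-‿distribˡ-*; -‿involutive)
  open Solver commutativeSemiring public using (solve; con; _:+_; _:*_; _:=_)

  +-mono-≤ : ∀ {a b c d} → a ≤ b → c ≤ d → a + c ≤ b + d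
  +-mono-≤ {a} {b} {c} {d} a≤b c≤d = ≤.trans (+-monoʳ-≤ a c≤d)
    (≤.trans (≤.reflexive (+-comm a d)) (≤.trans (+-monoʳ-≤ d a≤b) (≤.reflexive (+-comm d b))))

  -‿+-cancel : ∀ z x → - z + (z + x) ≈ x
  -‿+-cancel z x = ≈-trans (≈-sym (+-assoc (- z) z x)) (≈-trans (+-congʳ (-‿inverseˡ z)) (+-identityˡ x))

  x-y+y≈x : ∀ x y → x - y + y ≈ x
  x-y+y≈x x y = ≈-trans (+-assoc x (- y) y) (≈-trans (+-congˡ (-‿inverseˡ y)) (+-identityʳ x))

  +-cancelˡ-≤ : ∀ z {x y} → z + x ≤ z + y → x ≤ y
  +-cancelˡ-≤ z {x} {y} le = ≤.trans (≤.reflexive (≈-sym (-‿+-cancel z x)))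
    (≤.trans (+-monoʳ-≤ (- z) le) (≤.reflexive (-‿+-cancel z y)))

  -- "a ≤ b because b − a equals q − p", with both sides moved so that the
  -- equation is a semiring identity.
  ≤-from : ∀ {p q a b} → p ≤ q → b + p ≈ a + q → a ≤ b
  ≤-from {p} {q} {a} {b} p≤q eq = +-cancelˡ-≤ p
    (≤.trans (≤.reflexive (+-comm p a)) (≤.trans (+-monoʳ-≤ a p≤q)
      (≤.trans (≤.reflexive (≈-sym eq)) (≤.reflexive (+-comm b p)))))

  x-y≤z⇒x≤z+y : ∀ {x y z} → x - y ≤ z → x ≤ z + y
  x-y≤z⇒x≤z+y {x} {y} x-y≤z = ≤.trans (≤.reflexive (≈-sym (x-y+y≈x x y))) (+-mono-≤ x-y≤z ≤.refl)

  x≤z+y⇒x-y≤z : ∀ {x y z} → x ≤ z + y → x - y ≤ z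
  x≤z+y⇒x-y≤z {x} {y} {z} x≤z+y = +-cancelˡ-≤ y (≤.trans (≤.reflexive (≈-trans (+-comm y _) (x-y+y≈x x y)))
    (≤.trans x≤z+y (≤.reflexive (+-comm z y))))

  ≰⇒≥ : ∀ {x y} → ¬ (x ≤ y) → y ≤ x
  ≰⇒≥ {x} {y} x≰y with ≤.total x y
  ... | inj₁ x≤y = contradiction x≤y x≰y
  ... | inj₂ y≤x = y≤x

  0≤1 : 0# ≤ 1#
  0≤1 with ≤.total 0# 1#
  ... | inj₁ 0≤1 = 0≤1
  ... | inj₂ 1≤0 = ≤.trans (*-nonNeg 0≤-1 0≤-1) (≤.reflexive (≈-trans (≈-sym (-‿distribˡ-* 1# (- 1#)))
                     (≈-trans (-‿cong (*-identityˡ (- 1#))) (-‿involutive 1#))))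
    where
    0≤-1 : 0# ≤ - 1#
    0≤-1 = +-cancelˡ-≤ 1# (≤.trans (≤.reflexive (+-identityʳ 1#)) (≤.trans 1≤0 (≤.reflexive (≈-sym (-‿inverseʳ 1#)))))

  0≤x⇒y≤x+y : ∀ {x} y → 0# ≤ x → y ≤ x + y
  0≤x⇒y≤x+y y 0≤x = ≤.trans (≤.reflexive (≈-sym (+-identityˡ y))) (+-mono-≤ 0≤x ≤.refl)

  0≤y⇒x≤x+y : ∀ x {y} → 0# ≤ y → x ≤ x + y
  0≤y⇒x≤x+y x 0≤y = ≤.trans (≤.reflexive (≈-sym (+-identityʳ x))) (+-monoʳ-≤ x 0≤y)

  +-nonNeg : ∀ {x y} → 0# ≤ x → 0# ≤ y → 0# ≤ x + y
  +-nonNeg 0≤x 0≤y = ≤.trans 0≤x (0≤y⇒x≤x+y _ 0≤y)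

  fromℕ-nonNeg : ∀ n → 0# ≤ fromℕ n
  fromℕ-nonNeg zero    = ≤.refl
  fromℕ-nonNeg (suc n) = +-nonNeg 0≤1 (fromℕ-nonNeg n)

  fromℕ-mono : ∀ {m n} → m ℕ.≤ n → fromℕ m ≤ fromℕ n
  fromℕ-mono {n = n} ℕ.z≤n = fromℕ-nonNeg n
  fromℕ-mono (ℕ.s≤s m≤n)  = +-monoʳ-≤ 1# (fromℕ-mono m≤n)

  -- The differences of f and g are the increments of p; subtraction is avoided so that the semiring
  -- solver applies.
  sum-telescope : ∀ {n} (p : Fin (suc n) → Carrier) (f g : Fin n → Carrier) →
    (∀ i → f i + p (inject₁ i) ≈ g i + p (suc i)) → sum f + p zero ≈ sum g + p (Fin.fromℕ n)
  sum-telescope {zero}  p f g eq = ≈-refl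
  sum-telescope {suc n} p f g eq = begin
    (f zero + sum (f ∘ suc)) + p zero                ≈⟨ solve 3 (λ a b c → (a :+ b) :+ c := b :+ (a :+ c)) ≈-refl (f zero) _ (p zero) ⟩
    sum (f ∘ suc) + (f zero + p zero)                ≈⟨ +-congˡ (eq zero) ⟩
    sum (f ∘ suc) + (g zero + p (suc zero))          ≈⟨ solve 3 (λ a b c → a :+ (b :+ c) := b :+ (a :+ c)) ≈-refl _ (g zero) _ ⟩
    g zero + (sum (f ∘ suc) + p (suc zero))          ≈⟨ +-congˡ (sum-telescope (p ∘ suc) (f ∘ suc) (g ∘ suc) (eq ∘ suc)) ⟩
    g zero + (sum (g ∘ suc) + p (Fin.fromℕ (suc n))) ≈⟨ +-assoc _ _ _ ⟨
    (g zero + sum (g ∘ suc)) + p (Fin.fromℕ (suc n)) ∎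
    where open SetoidReasoning setoid

  listSum : ∀ {J : Set} → (J → Carrier) → List J → Carrier
  listSum F = foldr (λ j s → F j + s) 0#

  sum≈listSum : ∀ {J : Set} {n} (F : J → Carrier) (g : Fin n → J) → sum (F ∘ g) ≈ listSum F (tabulate g)
  sum≈listSum {n = zero}  F g = ≈-refl
  sum≈listSum {n = suc n} F g = +-congˡ (sum≈listSum F (g ∘ suc))

  listSum-evens-odds : ∀ {J : Set} (F : J → Carrier) js → listSum F js ≈ listSum F (evens js) + listSum F (odds js)
  listSum-evens-odds F []       = ≈-sym (+-identityˡ 0#)
  listSum-evens-odds F (j ∷ js) = ≈-trans (+-congˡ (listSum-evens-odds F js))
    (solve 3 (λ a b c → a :+ (b :+ c) := (a :+ c) :+ b) ≈-refl (F j) (listSum F (evens js)) (listSum F (odds js)))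

  4*_ : Carrier → Carrier
  4* x = (x + x) + (x + x)

  4*-mono : ∀ {x y} → x ≤ y → 4* x ≤ 4* y
  4*-mono x≤y = +-mono-≤ (+-mono-≤ x≤y x≤y) (+-mono-≤ x≤y x≤y)

  4*-nonNeg : ∀ {x} → 0# ≤ x → 0# ≤ 4* x
  4*-nonNeg 0≤x = +-nonNeg (+-nonNeg 0≤x 0≤x) (+-nonNeg 0≤x 0≤x)

  -- Removing vertices from a weighted path.

  module Removal {V : Set} (Step : Carrier → V → V → Set)
    (Step-mono : ∀ {x y u v} → x ≤ y → Step x u v → Step y u v)
    (Step-sym : ∀ {x u v} → Step x u v → Step x v u) where

    Conn : Carrier → V → V → Set
    Conn x = Star (Step x)

    Conn-mono : ∀ {x y u v} → x ≤ y → Conn x u v → Conn y u v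
    Conn-mono x≤y = Star.map (Step-mono x≤y)

    Conn-sym : ∀ {x u v} → Conn x u v → Conn x v u
    Conn-sym = Star.reverse Step-sym

    -- Neighbours are joined by a walk rather than by one step, since removals route edges through
    -- removed vertices. An edge counts its bound x once, however long the walk.
    data Path : List V → Carrier → Set where
      empty  : Path [] 0#
      single : ∀ v → Path (v ∷ []) 0#
      edge   : ∀ {u v vs x W} → 0# ≤ x → Conn x u v → Path (v ∷ vs) W → Path (u ∷ v ∷ vs) (x + W)

    Path-nonNeg : ∀ {vs W} → Path vs W → 0# ≤ W
    Path-nonNeg empty          = ≤.refl
    Path-nonNeg (single _)     = ≤.refl
    Path-nonNeg (edge 0≤x _ p) = +-nonNeg 0≤x (Path-nonNeg p)

    -- Here x is the weight saved, and v a surviving vertex to which u is connected by steps of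
    -- weight at most x; this v lets x pay for u.
    record Removed (u : V) (vs : List V) (W : Carrier) : Set where
      constructor removed
      field
        {x W′} : Carrier
        {v}    : V
        v∈vs   : v ∈ vs
        0≤x    : 0# ≤ x
        conn   : Conn x u v
        path   : Path vs W′
        x+W′≤W : x + W′ ≤ W

    -- The cheaper of the two edges at u is dropped; the other one, being at
    -- least as heavy, joins the two neighbours of u.
    remove : ∀ vs {u ws W} → Path (vs ++ u ∷ ws) W → vs ++ ws ≡ [] ⊎ Removed u (vs ++ ws) W
    remove [] (single _) = inj₁ refl
    remove [] (edge 0≤x c p) = inj₂ (removed (here refl) 0≤x c p ≤.refl)
    remove (a ∷ []) (edge 0≤x c (single _)) = inj₂ (removed (here refl) 0≤x (Conn-sym c) (single a) ≤.refl)
    remove (a ∷ []) (edge {x = x} 0≤x c (edge {x = y} {W = W} 0≤y c′ p)) with ≤.total x y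
    ... | inj₁ x≤y = inj₂ (removed (here refl) 0≤x (Conn-sym c) (edge 0≤y (Conn-mono x≤y c ◅◅ c′) p) ≤.refl)
    ... | inj₂ y≤x = inj₂ (removed (there (here refl)) 0≤y c′ (edge 0≤x (c ◅◅ Conn-mono y≤x c′) p)
                       (≤.reflexive (solve 3 (λ x y W → y :+ (x :+ W) := x :+ (y :+ W)) ≈-refl x y W)))
    remove (a ∷ b ∷ vs) (edge {x = x} 0≤x c p) with remove (b ∷ vs) p
    ... | inj₂ (removed {y} {W′} v∈ 0≤y c′ p′ le) = inj₂ (removed (there v∈) 0≤y c′ (edge 0≤x c p′)
      (≤-from le (solve 4 (λ x y W W′ → (x :+ W) :+ (y :+ W′) := (y :+ (x :+ W′)) :+ W) ≈-refl x y _ W′)))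

    module _ {J : Set} (e : J → V) (F : J → Carrier) (B : Carrier) (0≤B : 0# ≤ B) where

      -- Quantified over x, because the weight that joins the two is known only when i is removed.
      Bounds : J → J → Set
      Bounds i j = ∀ x → 0# ≤ x → Conn x (e i) (e j) → F i ≤ 4* x

      -- B pays for the last element of js, which no later one bounds.
      removalBound : ∀ skip js {vs W} → Path vs W → vs ↭ skip ++ map e js →
                     AllPairs Bounds js → All (λ j → F j ≤ B) js → listSum F js ≤ 4* W + B
      -- Skipped vertices are removed first and are charged nothing.
      removalBound (s ∷ skip) js {vs} {W} p vs↭ bounds F≤B with ∈-∃++ (∈-resp-↭ (↭-sym vs↭) (here refl))
      ... | as , bs , refl with drop-mid as [] vs↭ | remove as p
      ...   | rest | inj₂ (removed {x} {W′} _ 0≤x _ p′ x+W′≤W) = ≤.trans (removalBound skip js p′ rest bounds F≤B)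
        (+-mono-≤ (4*-mono (≤.trans (0≤x⇒y≤x+y W′ 0≤x) x+W′≤W)) ≤.refl)
      ...   | rest | inj₁ eq = ≤.trans (removalBound skip js empty (subst (_↭ _) eq rest) bounds F≤B)
        (+-mono-≤ (4*-mono (Path-nonNeg p)) ≤.refl)
      removalBound [] [] p _ _ _ = +-nonNeg (4*-nonNeg (Path-nonNeg p)) 0≤B
      -- After `e j` is removed, only vertices of later elements remain, so the surviving vertex is
      -- `e k` with k in js, and `Bounds j k` charges F j to the weight saved.
      removalBound [] (j ∷ js) {vs} {W} p vs↭ (bs ∷ bounds) (Fj≤B ∷ F≤B) with ∈-∃++ (∈-resp-↭ (↭-sym vs↭) (here refl))
      ... | as , as′ , refl with drop-mid as [] vs↭ | remove as p
      ...   | rest | inj₂ (removed {x} {W′} v∈ 0≤x conn p′ x+W′≤W) with ∈-map⁻ e (∈-resp-↭ rest v∈)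
      ...     | k , k∈js , refl = ≤-from
        (+-mono-≤ (All.lookup bs k∈js x 0≤x conn) (+-mono-≤ (removalBound [] js p′ rest bounds F≤B) (4*-mono x+W′≤W)))
        (solve 6 (λ f s x W′ W B →
            (((W :+ W) :+ (W :+ W)) :+ B) :+ (f :+ (s :+ (((x :+ W′) :+ (x :+ W′)) :+ ((x :+ W′) :+ (x :+ W′)))))
            := (f :+ s) :+ (((x :+ x) :+ (x :+ x)) :+ (((((W′ :+ W′) :+ (W′ :+ W′)) :+ B)) :+ ((W :+ W) :+ (W :+ W)))))
          ≈-refl (F j) (listSum F js) x W′ W B)
      removalBound [] (j ∷ []) p vs↭ _ (Fj≤B ∷ _) | _ | _ | inj₁ eq = ≤.trans (≤.reflexive (+-identityʳ _))
        (≤.trans Fj≤B (0≤x⇒y≤x+y B (4*-nonNeg (Path-nonNeg p))))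
      removalBound [] (j ∷ _ ∷ _) p vs↭ _ _ | _ | rest | inj₁ eq =
        contradiction (↭-empty-inv (↭-sym (subst (_↭ _) eq rest))) λ ()

  -- Covering an interval by stretches with multiplicity two.

  module Covering (G C : ℕ → Carrier)
    (G-mono : ∀ {x y} → x ℕ.≤ y → G x ≤ G y) (C-mono : ∀ {x y} → x ℕ.≤ y → C x ≤ C y) (m : ℕ) where

    -- Subtraction-free form of G y - G x ≤ C y - C x.
    Good : ℕ → ℕ → Set
    Good x y = G y + C x ≤ G x + C y

    CoveredUpTo : ℕ → ℕ → Set
    CoveredUpTo k n = ∃₂ λ x y → x ℕ.≤ n × n ℕ.< y × y ℕ.≤ k × Good x y

    NoneBeyond : ℕ → ℕ → Set
    NoneBeyond k n = ∀ x y → x ℕ.≤ n → k ℕ.< y → y ℕ.≤ m → ¬ Good x y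

    -- The end y is searched downwards from k, so the first one that admits a start x ≤ n is the
    -- furthest; the given stretch ensures success.
    furthest : ∀ k n → k ℕ.≤ m → CoveredUpTo k n → NoneBeyond k n →
      ∃₂ λ x y → x ℕ.≤ n × n ℕ.< y × y ℕ.≤ m × Good x y × NoneBeyond y n
    furthest zero n _ (_ , _ , _ , n<y , y≤0 , _) _ = contradiction (ℕₚ.<-≤-trans n<y y≤0) λ ()
    furthest (suc k) n k<m (x , y , x≤n , n<y , y≤1+k , good) none
      with ℕₚ.anyUpTo? (λ x → (G (suc k) + C x) ≤.≤? (G x + C (suc k))) (suc n)
    ... | yes (x′ , ℕ.s≤s x′≤n , good′) = x′ , suc k , x′≤n , ℕₚ.<-≤-trans n<y y≤1+k , k<m , good′ , none
    ... | no ¬good = furthest k n (ℕₚ.<⇒≤ k<m) (x , y , x≤n , n<y , y≤k , good) none′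
      where
      y≤k : y ℕ.≤ k
      y≤k with ℕₚ.m≤n⇒m<n∨m≡n y≤1+k
      ... | inj₁ (ℕ.s≤s y≤k) = y≤k
      ... | inj₂ refl = contradiction (x , ℕ.s≤s x≤n , good) ¬good

      none′ : NoneBeyond k n
      none′ x′ y′ x′≤n k<y′ y′≤m good′ with ℕₚ.m≤n⇒m<n∨m≡n k<y′
      ... | inj₁ 1+k<y′ = none x′ y′ x′≤n 1+k<y′ y′≤m good′
      ... | inj₂ refl   = ¬good (x′ , ℕ.s≤s x′≤n , good′)

    module _ (covered : ∀ n → n ℕ.< m → CoveredUpTo m n) where

      -- Taking intervals that reach as far as possible, an interval starts after
      -- the point n₀ at which the last but one was chosen: no step is used thrice.
      sweep : ∀ fuel n n₀ → n ℕ.≤ m → m ℕ.≤ fuel ℕ.+ n → n₀ ℕ.≤ n →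
              (∀ x y → x ℕ.≤ n → n ℕ.< y → y ℕ.≤ m → Good x y → n₀ ℕ.≤ x) →
              G m + (C n + C n₀) ≤ G n + (C m + C m)
      sweep fuel n n₀ n≤m m≤ n₀≤n after with ℕₚ.m≤n⇒m<n∨m≡n n≤m
      ... | inj₂ refl = +-monoʳ-≤ (G n) (+-monoʳ-≤ (C n) (C-mono n₀≤n))
      sweep zero n n₀ n≤m m≤ n₀≤n after | inj₁ n<m = contradiction m≤ (ℕₚ.<⇒≱ n<m)
      sweep (suc fuel) n n₀ n≤m m≤ n₀≤n after | inj₁ n<m
        with furthest m n ℕₚ.≤-refl (covered n n<m) (λ _ _ _ m<y y≤m _ → ℕₚ.<⇒≱ m<y y≤m)
      ... | x , y , x≤n , n<y , y≤m , good , none = ≤-from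
        -- The sweep continues from y with n as the new bound on starts; G x ≤ G n and C n₀ ≤ C x
        -- absorb the overlap of stretches.
        (+-mono-≤ (+-mono-≤ (sweep fuel y n y≤m m≤′ (ℕₚ.<⇒≤ n<y) after′) good)
                  (+-mono-≤ (G-mono x≤n) (C-mono (after x y x≤n n<y y≤m good))))
        (solve 9 (λ Gm Cm Gn Cn Cn₀ Gx Cx Gy Cy →
            (Gn :+ (Cm :+ Cm)) :+ (((Gm :+ (Cy :+ Cn)) :+ (Gy :+ Cx)) :+ (Gx :+ Cn₀))
            := (Gm :+ (Cn :+ Cn₀)) :+ (((Gy :+ (Cm :+ Cm)) :+ (Gx :+ Cy)) :+ (Gn :+ Cx)))
          ≈-refl (G m) (C m) (G n) (C n) (C n₀) (G x) (C x) (G y) (C y))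
        where
        m≤′ : m ℕ.≤ fuel ℕ.+ y
        m≤′ = ℕₚ.≤-trans m≤ (ℕₚ.≤-trans (ℕₚ.≤-reflexive (sym (ℕₚ.+-suc fuel n))) (ℕₚ.+-monoʳ-≤ fuel n<y))

        after′ : ∀ x′ y′ → x′ ℕ.≤ y → y ℕ.< y′ → y′ ℕ.≤ m → Good x′ y′ → n ℕ.≤ x′
        after′ x′ y′ _ y<y′ y′≤m good′ with ℕₚ.≤-total n x′
        ... | inj₁ n≤x′ = n≤x′
        -- A good stretch from n or earlier to beyond y would contradict the choice of y.
        ... | inj₂ x′≤n = contradiction good′ (none x′ y′ x′≤n y<y′ y′≤m)

      cover : G m + (C 0 + C 0) ≤ G 0 + (C m + C m)
      cover = sweep m 0 0 ℕ.z≤n (ℕₚ.m≤m+n m 0) ℕ.z≤n λ _ _ _ _ _ _ → ℕ.z≤n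

  -- Partial sums and positions indexed by natural numbers.

  partialSum : (ℕ → Carrier) → ℕ → Carrier
  partialSum f zero    = 0#
  partialSum f (suc k) = partialSum f k + f k

  partialSum-shift : ∀ f n → f 0 + partialSum (f ∘ suc) n ≈ partialSum f (suc n)
  partialSum-shift f zero    = +-comm (f 0) 0#
  partialSum-shift f (suc n) = ≈-trans (≈-sym (+-assoc _ _ _)) (+-congʳ (partialSum-shift f n))

  sum≈partialSum : ∀ n f → sum {n} (f ∘ toℕ) ≈ partialSum f n
  sum≈partialSum zero    f = ≈-refl
  sum≈partialSum (suc n) f = ≈-trans (+-congˡ (sum≈partialSum n (f ∘ suc))) (partialSum-shift f n)

  mono-from-suc : ∀ {f : ℕ → Carrier} → (∀ k → f k ≤ f (suc k)) → ∀ {x y} → x ℕ.≤ y → f x ≤ f y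
  mono-from-suc {f} step x≤y = go (ℕₚ.≤⇒≤′ x≤y)
    where
    go : ∀ {x y} → x ℕ.≤′ y → f x ≤ f y
    go ℕ.≤′-refl        = ≤.refl
    go (ℕ.≤′-step x≤′y) = ≤.trans (go x≤′y) (step _)

-- Positions beyond n go to the last one, which makes tours total functions on the natural numbers.
clamp : ∀ n → ℕ → Fin (suc n)
clamp n       zero    = zero
clamp zero    (suc k) = zero
clamp (suc n) (suc k) = suc (clamp n k)

clamp-toℕ : ∀ {n} (i : Fin (suc n)) → clamp n (toℕ i) ≡ i
clamp-toℕ         zero    = refl
clamp-toℕ {suc n} (suc i) = cong suc (clamp-toℕ i)

-- Bounding the times of a condensed request set by the cost of a tour.

module Requests (K : OrderedField) {h : ℕ} (T : HST h)
  (R : Queueing.RequestSet K T) (leaves : Queueing.RequestSet.AtLeaves R) where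
  open Queueing K T
  open OrderedFieldProperties K public
  open Extrema totalOrder using (argmin; argmin-all; f[argmin]≤f[xs])

  t : Fin (suc (m R)) → Carrier
  t = time R

  δ : Fin (suc (m R)) → Fin (suc (m R)) → Carrier
  δ = d R

  δ-nonNeg : ∀ u v → 0# ≤ δ u v
  δ-nonNeg u v = fromℕ-nonNeg (dist (loc R u) (loc R v))

  δ-refl : ∀ u → δ u u ≤ 0#
  δ-refl u = ≤.reflexive (reflexive (cong fromℕ (dist-refl (loc R u))))

  δ-sym : ∀ u v → δ u v ≡ δ v u
  δ-sym u v = cong fromℕ (dist-sym (loc R u) (loc R v))

  δ-ultrametric : ∀ u v w {x} → δ u v ≤ x → δ v w ≤ x → δ u w ≤ x
  δ-ultrametric u v w uv≤x vw≤x
    with dist-ultrametric (loc R u) (loc R v) (loc R w) (leaves u) (leaves v) (leaves w)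
  ... | inj₁ le = ≤.trans (fromℕ-mono le) uv≤x
  ... | inj₂ le = ≤.trans (fromℕ-mono le) vw≤x

  δ-triangle : ∀ u v w → δ u w ≤ δ u v + δ v w
  δ-triangle u v w = δ-ultrametric u v w (0≤y⇒x≤x+y _ (δ-nonNeg v w)) (0≤x⇒y≤x+y _ (δ-nonNeg u v))

  -- A request v of least time above t u is consecutive to u, so condensedness yields a pair
  -- straddling the gap between them.
  spanning : Condensed R → ∀ u w → ¬ (t w ≤ t u) → ∃₂ λ a b → t a ≤ t u × ¬ (t b ≤ t u) × t b ≤ δ a b + t a
  spanning condensed u w above =
    let a , b , ta≤tu , tv≤tb , tb-ta≤δ = condensed u v consecutive
    in a , b , ta≤tu , (λ tb≤tu → v-above (≤.trans tv≤tb tb≤tu)) , x-y≤z⇒x≤z+y tb-ta≤δ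
    where
    Above : Fin (suc (m R)) → Set
    Above q = ¬ (t q ≤ t u)

    above? : ∀ q → Dec (Above q)
    above? q = ¬? (t q ≤.≤? t u)

    v : Fin (suc (m R))
    -- The default w lies above u itself, so the minimum does too.
    v = argmin t w (filter above? (allFin (suc (m R))))

    v-above : Above v
    v-above = argmin-all t {P = Above} above (Allₚ.all-filter above? (allFin (suc (m R))))

    v-least : ∀ q → Above q → t v ≤ t q
    v-least q q-above = All.lookup (f[argmin]≤f[xs] w (filter above? (allFin (suc (m R)))))
      (∈-filter⁺ above? (∈-allFin q) q-above)

    consecutive : Consecutive R u v
    consecutive = (λ u≡v → v-above (≤.reflexive (reflexive (cong t (sym u≡v)))))
      , ≰⇒≥ v-above
      , λ { q ((u≤q , u≉q) , (q≤v , q≉v)) → q≉v (≤.antisym q≤v (v-least q λ q≤u → u≉q (≤.antisym u≤q q≤u))) }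

  hop : Fin (suc (m R)) → Fin (suc (m R)) → Carrier
  hop u v = δ u v ⊔ (t u - t v)

  δ≤hop : ∀ u v → δ u v ≤ hop u v
  δ≤hop u v = x≤x⊔y (δ u v) (t u - t v)

  hop-nonNeg : ∀ u v → 0# ≤ hop u v
  hop-nonNeg u v = ≤.trans (δ-nonNeg u v) (δ≤hop u v)

  t≤hop+t : ∀ u v → t u ≤ hop u v + t v
  t≤hop+t u v = x-y≤z⇒x≤z+y (x≤y⊔x (δ u v) (t u - t v))

  module Tour (σ : Order (m R)) where
    open Order σ using (perm; dummyFirst)

    p : ℕ → Fin (suc (m R))
    p k = at σ (clamp (m R) k)

    pos : Fin (suc (m R)) → ℕ
    pos v = toℕ (perm ⟨$⟩ˡ v)

    pos≤m : ∀ v → pos v ℕ.≤ m R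
    pos≤m v = ℕ.s≤s⁻¹ (Finₚ.toℕ<n (perm ⟨$⟩ˡ v))

    p-pos : ∀ v → p (pos v) ≡ v
    p-pos v = trans (cong (at σ) (clamp-toℕ (perm ⟨$⟩ˡ v))) (inverseʳ perm)

    C : ℕ → Carrier
    C = partialSum λ k → hop (p k) (p (suc k))

    C-mono : ∀ {x y} → x ℕ.≤ y → C x ≤ C y
    C-mono = mono-from-suc λ k → 0≤y⇒x≤x+y (C k) (hop-nonNeg _ _)

    orderCost≈C : orderCost R σ ≈ C (m R)
    orderCost≈C = ≈-trans (reflexive (sum-cong-≗ λ i → cong₂ hop
        (sym (trans (cong p (sym (Finₚ.toℕ-inject₁ i))) (cong (at σ) (clamp-toℕ (inject₁ i)))))
        (sym (cong (at σ) (clamp-toℕ (suc i))))))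
      (sum≈partialSum (m R) λ k → hop (p k) (p (suc k)))

    δ+C≤C : ∀ {x y} → x ℕ.≤′ y → δ (p x) (p y) + C x ≤ C y
    δ+C≤C {x} ℕ.≤′-refl = ≤.trans (+-mono-≤ (δ-refl (p x)) ≤.refl) (≤.reflexive (+-identityˡ (C x)))
    δ+C≤C {x} (ℕ.≤′-step {y} x≤′y) = ≤-from
      (+-mono-≤ (δ-triangle (p x) (p y) (p (suc y))) (+-mono-≤ (δ+C≤C x≤′y) (δ≤hop (p y) (p (suc y)))))
      (solve 6 (λ xz xy yz Cx Cy hp → (Cy :+ hp) :+ (xz :+ ((xy :+ Cx) :+ yz)) := (xz :+ Cx) :+ ((xy :+ yz) :+ (Cy :+ hp)))
        ≈-refl (δ (p x) (p (suc y))) (δ (p x) (p y)) (δ (p y) (p (suc y))) (C x) (C y) (hop (p y) (p (suc y))))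

    δ+C≤C-pos : ∀ u v → pos u ℕ.≤ pos v → δ u v + C (pos u) ≤ C (pos v)
    δ+C≤C-pos u v u≤v = subst₂ (λ a b → δ a b + C (pos u) ≤ C (pos v)) (p-pos u) (p-pos v) (δ+C≤C (ℕₚ.≤⇒≤′ u≤v))

    δ≤orderCost : ∀ u v → δ u v ≤ orderCost R σ
    δ≤orderCost u v = ≤.trans bound (≤.reflexive (≈-sym orderCost≈C))
      where
      ordered : ∀ a b → pos a ℕ.≤ pos b → δ a b ≤ C (m R)
      ordered a b a≤b = ≤.trans (0≤y⇒x≤x+y _ (C-mono {0} {pos a} ℕ.z≤n))
        (≤.trans (δ+C≤C-pos a b a≤b) (C-mono (pos≤m b)))

      bound : δ u v ≤ C (m R)
      bound with ℕₚ.≤-total (pos u) (pos v)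
      ... | inj₁ u≤v = ordered u v u≤v
      ... | inj₂ v≤u = subst (_≤ C (m R)) (δ-sym v u) (ordered v u v≤u)

    -- Running maximum of the times: unlike the times along the tour it is monotone, as `Covering`
    -- requires.
    A : ℕ → Carrier
    A zero    = t (p 0)
    A (suc k) = A k ⊔ t (p (suc k))

    A-mono : ∀ {x y} → x ℕ.≤ y → A x ≤ A y
    A-mono = mono-from-suc λ k → x≤x⊔y (A k) (t (p (suc k)))

    t≤A : ∀ {x y} → x ℕ.≤ y → t (p x) ≤ A y
    t≤A {zero}  x≤y = A-mono x≤y
    t≤A {suc x} x≤y = ≤.trans (x≤y⊔x (A x) (t (p (suc x)))) (A-mono x≤y)

    t≤A-pos : ∀ v {y} → pos v ℕ.≤ y → t v ≤ A y
    t≤A-pos v {y} v≤y = subst (λ u → t u ≤ A y) (p-pos v) (t≤A v≤y)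

    A-attained : ∀ k → ∃ λ u → t u ≈ A k
    A-attained zero = p 0 , ≈-refl
    A-attained (suc k) with ⊔-sel (A k) (t (p (suc k))) | A-attained k
    ... | inj₁ eq | u , tu≈ = u , ≈-trans tu≈ (≈-sym eq)
    ... | inj₂ eq | _       = p (suc k) , ≈-sym eq

    -- If the maximum at y was set after x, the tour has since come back from it to t (p y), and a
    -- hop costs at least the time by which it goes back.
    descent : ∀ {x y} → x ℕ.≤′ y → A y ≤ A x ⊎ A y + C x ≤ t (p y) + C y
    descent ℕ.≤′-refl = inj₁ ≤.refl
    descent {x} (ℕ.≤′-step {y} x≤′y) with ⊔-sel (A y) (t (p (suc y)))
    ... | inj₂ eq = inj₂ (+-mono-≤ (≤.reflexive eq) (C-mono (ℕₚ.m≤n⇒m≤1+n (ℕₚ.≤′⇒≤ x≤′y))))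
    ... | inj₁ eq with descent x≤′y
    ...   | inj₁ le = inj₁ (≤.trans (≤.reflexive eq) le)
    ...   | inj₂ le = inj₂ (≤.trans (≤.reflexive (+-congʳ eq)) (≤-from (+-mono-≤ le (t≤hop+t (p y) (p (suc y))))
      (solve 6 (λ a c ty cy hp tz → (tz :+ (cy :+ hp)) :+ ((a :+ c) :+ ty) := (a :+ c) :+ ((ty :+ cy) :+ (hp :+ tz)))
        ≈-refl (A y) (C x) (t (p y)) (C y) (hop (p y) (p (suc y))) (t (p (suc y))))))

    descent-pos : ∀ {x} v → x ℕ.≤ pos v → A (pos v) ≤ A x ⊎ A (pos v) + C x ≤ t v + C (pos v)
    descent-pos {x} v x≤v = subst (λ u → A (pos v) ≤ A x ⊎ A (pos v) + C x ≤ t u + C (pos v)) (p-pos v)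
      (descent (ℕₚ.≤⇒≤′ x≤v))

    module _ (condensed : Condensed R) where

      2C : ℕ → Carrier
      2C k = C k + C k

      2C-mono : ∀ {x y} → x ℕ.≤ y → 2C x ≤ 2C y
      2C-mono x≤y = +-mono-≤ (C-mono x≤y) (C-mono x≤y)

      open Covering A 2C A-mono 2C-mono (m R)

      -- One copy of C pays for the descent from the maximum to t b, the other for the distance from
      -- a to b; hence `2C`.
      good-between : ∀ a b → pos a ℕ.≤ pos b → t b ≤ δ a b + t a → Good (pos a) (pos b)
      good-between a b a≤b tb≤ with descent-pos b a≤b
      ... | inj₁ le = +-mono-≤ le (2C-mono a≤b)
      ... | inj₂ le = ≤-from
        (+-mono-≤ (+-mono-≤ le tb≤) (+-mono-≤ (t≤A-pos a ℕₚ.≤-refl) (δ+C≤C-pos a b a≤b)))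
        (solve 7 (λ Ab Aa Ca Cb ta tb δab →
            (Aa :+ (Cb :+ Cb)) :+ (((Ab :+ Ca) :+ tb) :+ (ta :+ (δab :+ Ca)))
            := (Ab :+ (Ca :+ Ca)) :+ (((tb :+ Cb) :+ (δab :+ ta)) :+ (Aa :+ Cb)))
          ≈-refl (A (pos b)) (A (pos a)) (C (pos a)) (C (pos b)) (t a) (t b) (δ a b))

      -- A maximum set after n has to be descended from to reach a, whose time is at most A n, so
      -- the descent pays for the rise.
      good-return : ∀ n a → n ℕ.≤ pos a → t a ≤ A n → Good n (pos a)
      good-return n a n≤a ta≤ with descent-pos a n≤a
      ... | inj₁ le = +-mono-≤ le (2C-mono n≤a)
      ... | inj₂ le = ≤-from (+-mono-≤ (+-mono-≤ le ta≤) (C-mono n≤a))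
        (solve 5 (λ Aa An Cn Ca ta →
            (An :+ (Ca :+ Ca)) :+ (((Aa :+ Cn) :+ ta) :+ Cn) := (Aa :+ (Cn :+ Cn)) :+ (((ta :+ Ca) :+ An) :+ Ca))
          ≈-refl (A (pos a)) (A n) (C n) (C (pos a)) (t a))

      -- When p (suc n) sets a new record, use the pair a, b spanning the gap in
      -- time just above A n: the step from n to suc n lies between a and b,
      -- unless the tour returns from above A n to a later.
      covered : ∀ n → n ℕ.< m R → CoveredUpTo (m R) n
      covered n n<m with t (p (suc n)) ≤.≤? A n
      ... | yes le = n , suc n , ℕₚ.≤-refl , ℕₚ.≤-refl , n<m ,
                     +-mono-≤ (⊔-lub ≤.refl le) (2C-mono (ℕₚ.n≤1+n n))
      ... | no above with A-attained n
      ...   | u , tu≈A with spanning condensed u (p (suc n)) (λ le → above (≤.trans le (≤.reflexive tu≈A)))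
      ...     | a , b , ta≤tu , b-above , tb≤ = split (ℕₚ.≤-<-connex (pos a) n)
        where
        n<b : n ℕ.< pos b
        n<b = ℕₚ.≰⇒> λ b≤n → b-above (≤.trans (t≤A-pos b b≤n) (≤.reflexive (≈-sym tu≈A)))

        split : pos a ℕ.≤ n ⊎ n ℕ.< pos a → CoveredUpTo (m R) n
        split (inj₁ a≤n) = pos a , pos b , a≤n , n<b , pos≤m b ,
          good-between a b (ℕₚ.≤-trans a≤n (ℕₚ.<⇒≤ n<b)) tb≤
        split (inj₂ n<a) = n , pos a , ℕₚ.≤-refl , n<a , pos≤m a ,
          good-return n a (ℕₚ.<⇒≤ n<a) (≤.trans ta≤tu (≤.reflexive tu≈A))

      t≤4*orderCost : ∀ u → t u ≤ 4* orderCost R σ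
      t≤4*orderCost u = ≤.trans (t≤A-pos u (pos≤m u))
        -- The summand added on the left is four copies of `C 0`, which is zero. Using `2C` with
        -- multiplicity two gives the factor four.
        (≤.trans (0≤y⇒x≤x+y _ (4*-nonNeg ≤.refl))
        (≤.trans (cover covered) (≤.trans (+-mono-≤ A0≤0 ≤.refl)
          (≤.reflexive (≈-trans (+-identityˡ _) (+-cong (+-cong eq eq) (+-cong eq eq)))))))
        where
        eq = ≈-sym orderCost≈C
        A0≤0 : A 0 ≤ 0#
        A0≤0 = ≤.reflexive (≈-trans (reflexive (cong t dummyFirst)) (time-dummy R))

-- Bounding the latency of the algorithm by the cost of a tour.

module Competitiveness (K : OrderedField) {h : ℕ} (T : HST h)
  (R : Queueing.RequestSet K T) (leaves : Queueing.RequestSet.AtLeaves R) where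
  open Queueing K T
  open Requests K T R leaves
  open SumProperties +-commutativeMonoid using (∑-distrib-+)
  open MultProperties +-monoid using (×ᵤ≈×)
  open Extrema totalOrder using (argmin)

  record Step (x : Carrier) (u v : Fin (suc (m R))) : Set where
    constructor step
    field
      near   : δ u v ≤ x
      later  : t v ≤ x + t u
      sooner : t u ≤ x + t v

  Step-mono : ∀ {x y u v} → x ≤ y → Step x u v → Step y u v
  Step-mono x≤y (step a b c) = step (≤.trans a x≤y) (≤.trans b (+-mono-≤ x≤y ≤.refl)) (≤.trans c (+-mono-≤ x≤y ≤.refl))

  Step-sym : ∀ {x u v} → Step x u v → Step x v u
  Step-sym {u = u} {v} (step a b c) = step (≤.trans (≤.reflexive (reflexive (δ-sym v u))) a) c b

  open Removal Step Step-mono Step-sym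

  -- Bounds |t v − t u| as well, but unlike it has a sum along tours that telescopes.
  weight : Fin (suc (m R)) → Fin (suc (m R)) → Carrier
  weight u v = (hop u v + hop u v) + (t v - t u)

  weight+t : ∀ u v → weight u v + t u ≈ (hop u v + hop u v) + t v
  weight+t u v = ≈-trans (+-assoc _ _ _) (+-congˡ (x-y+y≈x (t v) (t u)))

  hop≤weight : ∀ u v → hop u v ≤ weight u v
  hop≤weight u v = ≤-from (t≤hop+t u v) (≈-trans (weight+t u v) (+-assoc _ _ _))

  weight-step : ∀ u v → Step (weight u v) u v
  weight-step u v = step
    (≤.trans (δ≤hop u v) (hop≤weight u v))
    (≤.trans (0≤x⇒y≤x+y (t v) (+-nonNeg (hop-nonNeg u v) (hop-nonNeg u v))) (≤.reflexive (≈-sym (weight+t u v))))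
    (≤.trans (t≤hop+t u v) (+-mono-≤ (hop≤weight u v) ≤.refl))

  tourWeight : ∀ {n} → (Fin (suc n) → Fin (suc (m R))) → Carrier
  tourWeight g = sum λ i → weight (g (inject₁ i)) (g (suc i))

  tour-path : ∀ {n} (g : Fin (suc n) → Fin (suc (m R))) → Path (tabulate g) (tourWeight g)
  tour-path {zero}  g = single (g zero)
  tour-path {suc n} g = edge (≤.trans (hop-nonNeg _ _) (hop≤weight (g zero) (g (suc zero))))
    (weight-step (g zero) (g (suc zero)) ◅ ε) (tour-path (g ∘ suc))

  -- The time differences telescope, leaving twice the cost plus the end time minus the nonnegative
  -- start time.
  tourWeight≤ : Condensed R → ∀ σ → tourWeight (at σ) ≤ (orderCost R σ + orderCost R σ) + 4* orderCost R σ
  tourWeight≤ condensed σ = ≤.trans (0≤y⇒x≤x+y _ (time-nonNeg R (at σ zero)))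
    (≤.trans (≤.reflexive (sum-telescope (t ∘ at σ) _ _ λ i → weight+t (at σ (inject₁ i)) (at σ (suc i))))
      (+-mono-≤ (≤.reflexive (∑-distrib-+ hops hops)) (Tour.t≤4*orderCost σ condensed _)))
    where
    hops : Fin (m R) → Carrier
    hops i = hop (at σ (inject₁ i)) (at σ (suc i))

  module Ordered (π : Order (m R))
    (respects : ∀ i j → i Fin.< j → t (at π i) - t (at π j) ≤ δ (at π i) (at π j))
    (N : Fin (m R) → Carrier) where
    open Order π using (perm)

    before : Fin (m R) → Fin (suc (m R))
    before i = at π (inject₁ i)

    rank : Fin (suc (m R)) → Fin (suc (m R))
    rank q = perm ⟨$⟩ˡ q

    at-rank : ∀ q → at π (rank q) ≡ q
    at-rank q = inverseʳ perm

    -- Measured from the predecessor's time, not from the request's own as `latency` is, since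
    -- `walk` starts at the predecessor.
    F : Fin (m R) → Carrier
    F i = N i - t (before i)

    module _ (late : ∀ i q → 2 ℕ.+ toℕ i ℕ.≤ toℕ (rank q) → N i ≤ t q + δ q (before i)) where

      -- The order respects distances, so a request ordered before another one is issued later by at
      -- most their distance.
      early : ∀ i q {x} → 0# ≤ x → δ (before i) q ≤ x → toℕ (rank q) ℕ.≤ toℕ i → t q ≤ x + t (before i)
      early i q {x} 0≤x near q≤i with ℕₚ.m≤n⇒m<n∨m≡n q≤i
      ... | inj₁ q<i = ≤.trans
        (x-y≤z⇒x≤z+y (subst (λ q → t q - t (before i) ≤ δ q (before i)) (at-rank q)
          (respects (rank q) (inject₁ i) (subst (toℕ (rank q) ℕ.<_) (sym (Finₚ.toℕ-inject₁ i)) q<i))))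
        (+-mono-≤ (≤.trans (≤.reflexive (reflexive (δ-sym q (before i)))) near) ≤.refl)
      ... | inj₂ q≡i = ≤.trans (≤.reflexive (reflexive (cong t q≡before))) (0≤x⇒y≤x+y _ 0≤x)
        where
        q≡before : q ≡ before i
        q≡before = trans (sym (at-rank q)) (cong (at π) (Finₚ.toℕ-injective (trans q≡i (sym (Finₚ.toℕ-inject₁ i)))))

      -- Follow the walk until it first leaves the positions up to suc i.  Before
      -- that it stays early, except possibly at the one request following i.
      walk : ∀ i j {x} → 0# ≤ x → 2 ℕ.+ toℕ i ℕ.≤ toℕ j → Conn x (before i) (at π j) → F i ≤ 4* x
      walk i j {x} 0≤x i+2≤j conn = go conn (≤.trans (δ-refl (before i)) 0≤x) (inj₁ (0≤x⇒y≤x+y _ 0≤x))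
          (ℕₚ.≤-trans (ℕₚ.≤-reflexive (trans (cong toℕ (inverseˡ perm)) (Finₚ.toℕ-inject₁ i))) (ℕₚ.n≤1+n _))
        where
        t₀ : Carrier
        t₀ = t (before i)

        t≤2x+t₀ : ∀ {q} → t q ≤ x + t₀ ⊎ (toℕ (rank q) ≡ suc (toℕ i) × t q ≤ (x + x) + t₀) → t q ≤ (x + x) + t₀
        t≤2x+t₀ (inj₁ le)       = ≤.trans le (+-mono-≤ (0≤x⇒y≤x+y x 0≤x) ≤.refl)
        t≤2x+t₀ (inj₂ (_ , le)) = le

        go : ∀ {q} → Conn x q (at π j) → δ (before i) q ≤ x →
             t q ≤ x + t₀ ⊎ (toℕ (rank q) ≡ suc (toℕ i) × t q ≤ (x + x) + t₀) →
             toℕ (rank q) ℕ.≤ suc (toℕ i) → F i ≤ 4* x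
        go ε _ _ q≤ = contradiction (subst (λ r → toℕ r ℕ.≤ suc (toℕ i)) (inverseˡ perm) q≤) (ℕₚ.<⇒≱ i+2≤j)
        go {q} (_◅_ {j = r} (step near later _) conn) q-near state q≤
          with r-near ← δ-ultrametric (before i) q r q-near near | ℕₚ.≤-<-connex (toℕ (rank r)) (toℕ i)
        ... | inj₁ r≤i = go conn r-near (inj₁ (early i r 0≤x r-near r≤i)) (ℕₚ.m≤n⇒m≤1+n r≤i)
        ... | inj₂ i<r with ℕₚ.m≤n⇒m<n∨m≡n i<r
        -- From q, at time at most t₀ + 2x, the step reaches r by t₀ + 3x; the distance from r back
        -- to `before i` is the fourth x.
        ...   | inj₁ i+2≤r = x≤z+y⇒x-y≤z (≤-from
          (+-mono-≤ (+-mono-≤ (late i r i+2≤r) later)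
                    (+-mono-≤ (t≤2x+t₀ state) (≤.trans (≤.reflexive (reflexive (δ-sym r (before i)))) r-near)))
          (solve 6 (λ n x t₀ tr tq δr →
              (((x :+ x) :+ (x :+ x)) :+ t₀) :+ ((n :+ tr) :+ (tq :+ δr))
              := n :+ (((tr :+ δr) :+ (x :+ tq)) :+ (((x :+ x) :+ t₀) :+ x)))
            ≈-refl (N i) x t₀ (t r) (t q) (δ r (before i))))
        ...   | inj₂ i+1≡r = go conn r-near (inj₂ (sym i+1≡r , next state)) (ℕₚ.≤-reflexive (sym i+1≡r))
          where
          next : t q ≤ x + t₀ ⊎ (toℕ (rank q) ≡ suc (toℕ i) × t q ≤ (x + x) + t₀) → t r ≤ (x + x) + t₀
          next (inj₁ le) = ≤.trans later (≤.trans (+-monoʳ-≤ x le) (≤.reflexive (≈-sym (+-assoc x x t₀))))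
          -- Both q and r have position i + 1, so they coincide and no further x is lost.
          next (inj₂ (q≡ , le)) = subst (λ q → t q ≤ (x + x) + t₀) q≡r le
            where
            q≡r : q ≡ r
            q≡r = trans (sym (at-rank q)) (trans (cong (at π) (Finₚ.toℕ-injective (trans q≡ i+1≡r))) (at-rank r))

      module _ (final : ∀ i → suc (toℕ i) ≡ m R → N i ≤ t (at π (suc i)) + δ (at π (suc i)) (before i))
               (condensed : Condensed R) (σ : Order (m R)) where

        cost : Carrier
        cost = orderCost R σ

        last : Fin (suc (m R))
        last = at π (Fin.fromℕ (m R))

        -- The final request is late enough for every i except the last, where `final` takes over.
        N≤last : ∀ i → N i ≤ t last + δ last (before i)
        N≤last i with ℕₚ.m≤n⇒m<n∨m≡n (Finₚ.toℕ<n i)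
        ... | inj₁ i+1<m = late i last (subst (2 ℕ.+ toℕ i ℕ.≤_)
                             (sym (trans (cong toℕ (inverseˡ perm)) (Finₚ.toℕ-fromℕ (m R)))) i+1<m)
        ... | inj₂ i+1≡m = subst (λ j → N i ≤ t (at π j) + δ (at π j) (before i))
                             (Finₚ.toℕ-injective (trans i+1≡m (sym (Finₚ.toℕ-fromℕ (m R))))) (final i i+1≡m)

        cost-nonNeg : 0# ≤ cost
        cost-nonNeg = ≤.trans (δ-nonNeg zero zero) (Tour.δ≤orderCost σ zero zero)

        -- Four costs bound the time of `last`, the fifth its distance. This serves as B in
        -- `removalBound`.
        F≤5*cost : ∀ i → F i ≤ 4* cost + cost
        F≤5*cost i = x≤z+y⇒x-y≤z (≤.trans (N≤last i) (≤.trans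
          (+-mono-≤ (Tour.t≤4*orderCost σ condensed last) (Tour.δ≤orderCost σ last (before i)))
          (0≤y⇒x≤x+y _ (time-nonNeg R (before i)))))

        spacedSum : ∀ skip js → skip ++ js ↭ allFin (m R) → AllPairs 2+_≤_ js →
                    listSum F js ≤ 4* tourWeight (at σ) + (4* cost + cost)
        spacedSum skip js skip++js↭ spaced = removalBound before F (4* cost + cost)
          (+-nonNeg (4*-nonNeg cost-nonNeg) cost-nonNeg)
          -- The request `last` precedes no other, hence is `before i` for no i, and is skipped
          -- along with the other parity.
          (last ∷ map before skip) js (tour-path (at σ)) tour↭
          (AllPairs.map (λ {i} {j} i+2≤j x 0≤x →
            walk i (inject₁ j) 0≤x (subst (2 ℕ.+ toℕ i ℕ.≤_) (sym (Finₚ.toℕ-inject₁ j)) i+2≤j)) spaced)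
          (All.universal F≤5*cost js)
          where
          open PermutationReasoning
          tour↭ : tabulate (at σ) ↭ last ∷ map before skip ++ map before js
          tour↭ = begin
            tabulate (at σ)                          ↭⟨ tabulate-permutation (Order.perm σ) ⟩
            allFin (suc (m R))                       ↭⟨ tabulate-permutation perm ⟨
            tabulate (at π)                          ↭⟨ tabulate-last (at π) ⟩
            last ∷ tabulate before                   ≡⟨ cong (last ∷_) (Listₚ.map-tabulate id before) ⟨
            last ∷ map before (allFin (m R))         ↭⟨ prep last (map⁺ before skip++js↭) ⟨
            last ∷ map before (skip ++ js)           ≡⟨ cong (last ∷_) (Listₚ.map-++ before skip js) ⟩
            last ∷ map before skip ++ map before js  ∎

        sumF≤ : sum F ≤ fromℕ 58 * cost
        sumF≤ = ≤.trans (≤.reflexive (≈-trans (sum≈listSum F id) (listSum-evens-odds F (allFin (m R)))))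
          (≤.trans (+-mono-≤
              (≤.trans (spacedSum (odds is) (evens is) (↭-trans (++-comm (odds is) (evens is)) (evens++odds↭ is)) (evens-spaced is<)) bound)
              (≤.trans (spacedSum (evens is) (odds is) (evens++odds↭ is) (odds-spaced is<)) bound))
            -- The tour weighs at most 6 costs, so each parity contributes 4 · 6 + 5 = 29. `×ᵤ≈×`
            -- turns the solver's numeral into `fromℕ 58`.
            (≤.reflexive (≈-trans (solve 1 (λ c →
                let 4c = (c :+ c) :+ (c :+ c) ; w = (c :+ c) :+ 4c ; s = ((w :+ w) :+ (w :+ w)) :+ (4c :+ c) in
                s :+ s := con 58 :* c)
              ≈-refl cost) (*-congʳ (≈-sym (×ᵤ≈× 58 1#))))))
          where
          is : List (Fin (m R))
          is = allFin (m R)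

          is< : AllPairs Fin._<_ is
          is< = AllPairsₚ.tabulate⁺-< id

          bound : 4* tourWeight (at σ) + (4* cost + cost) ≤ 4* ((cost + cost) + 4* cost) + (4* cost + cost)
          bound = +-mono-≤ (4*-mono (tourWeight≤ condensed σ)) ≤.refl

  -- The sums of `latency` and F differ by the time of the final request minus that of the dummy,
  -- which is nonnegative.
  totalLatency≤ : Condensed R → (E : Execution R) →
    (∀ i j → i Fin.< j → t (cur E i) + latency E i ≤ t (cur E j) + δ (cur E j) (prev E i)) →
    (∀ i → suc (toℕ i) ≡ m R → t (cur E i) + latency E i ≤ t (cur E i) + δ (cur E i) (prev E i)) →
    (∀ i j → i Fin.< j → t (at (order E) i) - t (at (order E) j) ≤ δ (at (order E) i) (at (order E) j)) →
    totalLatency E ≤ fromℕ 58 * OPT R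
  totalLatency≤ condensed E latencyRespects finalRespects respects =
    ≤.trans (0≤y⇒x≤x+y _ (time-nonNeg R _))
      (≤.trans (≤.reflexive (≈-sym telescoped))
        (≤.trans (≤.reflexive (≈-trans (+-congˡ t-first) (+-identityʳ _)))
          (sumF≤ late final condensed optimal)))
    where
    -- By definition `OPT R` is the cost of this order.
    optimal : Order (m R)
    optimal = argmin (orderCost R) (mkOrder Perm.id refl) (allOrders (m R))

    t-first : t (at (order E) zero) ≈ 0#
    t-first = ≈-trans (reflexive (cong t (Order.dummyFirst (order E)))) (time-dummy R)

    N : Fin (m R) → Carrier
    N i = informTime E i ⊔ t (prev E i)

    open Ordered (order E) respects N using (F; rank; at-rank; sumF≤)

    N≈ : ∀ i → N i ≈ t (cur E i) + latency E i
    N≈ i = ≈-sym (≈-trans (+-comm _ _) (x-y+y≈x (N i) (t (cur E i))))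

    telescoped : sum F + t (at (order E) zero) ≈ sum (latency E) + t (at (order E) (Fin.fromℕ (m R)))
    telescoped = sum-telescope (t ∘ at (order E)) F (latency E) λ i →
      ≈-trans (x-y+y≈x (N i) (t (prev E i))) (≈-sym (x-y+y≈x (N i) (t (cur E i))))

    late : ∀ i q → 2 ℕ.+ toℕ i ℕ.≤ toℕ (rank q) → N i ≤ t q + δ q (prev E i)
    late i q i+2≤q = subst (λ r → N i ≤ t r + δ r (prev E i)) (at-rank q) (at-position (rank q) i+2≤q)
      where
      at-position : ∀ j → 2 ℕ.+ toℕ i ℕ.≤ toℕ j → N i ≤ t (at (order E) j) + δ (at (order E) j) (prev E i)
      at-position (suc j) (ℕ.s≤s i<j) = ≤.trans (≤.reflexive (N≈ i)) (latencyRespects i j i<j)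

    final : ∀ i → suc (toℕ i) ≡ m R → N i ≤ t (cur E i) + δ (cur E i) (prev E i)
    final i i+1≡m = ≤.trans (≤.reflexive (N≈ i)) (finalRespects i i+1≡m)

theorem3 : Σ ℕ λ c → 0 ℕ.< c ×
    ((K : OrderedField) {h : ℕ} (T : HST h) →
    let open OrderedField K in
    let open Queueing K T in
    (ALG : Algorithm) →
    HasDistanceRespectingLatency ALG →
    HasDistanceRespectingFinalLatency ALG →
    HasDistanceRespectingOrder ALG →
    (R : RequestSet) → AtLeaves R → Condensed R →
    (E : Execution R) → ALG R E →
    totalLatency E ≤ fromℕ c * OPT R)
theorem3 = 58 , ℕ.z<s , λ K T ALG latencyRespects finalRespects orderRespects R leaves condensed E run →
  Competitiveness.totalLatency≤ K T R leaves condensed E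
    (latencyRespects R E run) (finalRespects R E run) (orderRespects R E run)
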